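{- Let $G$ and $H$ be non-trivial graphs, and let $T$ and $T'$ be spanning trees of $G$ and $H$, respectively. Then $DD_{\mathrm{m}}(G \,\square\, H) \leq DD_{\mathrm{m}}(T \,\square\, T')$.
   Context: Graphs are finite, simple and undirected; a graph is non-trivial if it has at least two vertices. $G\,\square\,H$ denotes the Cartesian product: vertex set $V(G)\times V(H)$, with $(a,b)$ and $(c,d)$ adjacent iff $a=c$ and $bd\in E(H)$, or $ac\in E(G)$ and $b=d$. Swap number: a dominating set $D$ of a graph $G$ is a swap set if there is a dominating set $D'$ of $G$ with $D\cap D'=\emptyset$, $|D|=|D'|$, such that $G$ contains a perfect matching between $D$ and $D'$ (a bijection $f:D\to D'$ with $x f(x)\in E(G)$ for all $x\in D$). $DD_{\mathrm{m}}(G)$ is the minimum cardinality of a swap set of $G$, and $DD_{\mathrm{m}}(G)=\infty$ if none exists. -}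

module Defs where

open import Level using (0ℓ)
open import Data.Nat.Base using (ℕ; zero; suc; _*_; _≤_; _<_)
open import Data.Nat.Properties using (≮⇒≥; _<?_) renaming (_≟_ to _≟ℕ_)
open import Data.Nat.Induction using (<-rec)
open import Data.Fin.Base using (Fin; remQuot)
open import Data.Fin.Properties using (_≟_; any?; all?)
open import Data.Fin.Subset using (Subset; _∈_; _∩_; ∣_∣; Empty)
open import Data.Fin.Subset.Properties using (_∈?_; nonempty?; anySubset?)
open import Data.List.Base using (List; _∷_; _∷ʳ_; length)
open import Data.List.Relation.Unary.Linked using (Linked)
open import Data.List.Relation.Unary.Unique.Propositional using (Unique)
open import Data.Product.Base using (∃; Σ; _×_; _,_; proj₁; proj₂)
open import Data.Sum.Base using (_⊎_; inj₁; inj₂)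
open import Data.Vec.Base using (Vec; []; _∷_; lookup; tabulate)
open import Data.Vec.Properties using (lookup∘tabulate)
open import Data.Vec.Properties.WithK using ([]=-irrelevant)
open import Function.Bundles using (_⤖_; mk⤖; module Bijection)
open import Relation.Binary.Core using (Rel; _⇒_)
open import Relation.Binary.Definitions using (Symmetric; Irreflexive; Decidable)
open import Relation.Binary.Construct.Closure.ReflexiveTransitive using (Star)
open import Relation.Binary.Construct.Add.Supremum.NonStrict _≤_ public
  using () renaming (_≤⁺_ to _≤∞_)
open import Relation.Binary.PropositionalEquality using (_≡_; refl; sym; trans; cong; subst)
open import Relation.Nullary using (¬_; Dec; yes; no; contradiction)
open import Relation.Nullary.Construct.Add.Supremum using (_⁺; [_]; ⊤⁺)
open import Relation.Nullary.Decidable using (map′; ¬?; _×-dec_; _⊎-dec_; _→-dec_)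
open import Relation.Unary using (Pred) renaming (Decidable to Decidable₁)

record Graph (n : ℕ) : Set₁ where
  field
    Adj    : Rel (Fin n) 0ℓ
    Adj?   : Decidable Adj
    symm   : Symmetric Adj
    irrefl : Irreflexive _≡_ Adj

open Graph public

NonTrivial : ∀ {n} → Graph n → Set
NonTrivial {n} _ = 2 ≤ n

□-Adj : ∀ {m n} → Graph m → Graph n → Rel (Fin m × Fin n) 0ℓ
□-Adj G H (a , b) (c , d) = (a ≡ c × Adj H b d) ⊎ (Adj G a c × b ≡ d)

infixl 7 _□_

-- Fin (m * n) stands for Fin m × Fin n, through the bijection remQuot.

_□_ : ∀ {m n} → Graph m → Graph n → Graph (m * n)
_□_ {m} {n} G H = record
  { Adj    = λ u v → □-Adj G H (remQuot {m} n u) (remQuot {m} n v)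
  ; Adj?   = λ u v → dec (remQuot {m} n u) (remQuot {m} n v)
  ; symm   = λ where
      (inj₁ (p , e)) → inj₁ (sym p , symm H e)
      (inj₂ (e , p)) → inj₂ (symm G e , sym p)
  ; irrefl = λ where
      refl (inj₁ (_ , e)) → irrefl H refl e
      refl (inj₂ (e , _)) → irrefl G refl e
  }
  where
  dec : Decidable (□-Adj G H)
  dec (a , b) (c , d) =
    (a ≟ c ×-dec Adj? H b d) ⊎-dec (Adj? G a c ×-dec b ≟ d)

Connected : ∀ {n} → Graph n → Set
Connected G = ∀ u v → Star (Adj G) u v

-- v , vs is a cycle v — v₁ — ⋯ — vₖ — v with k ≥ 2 and v, v₁, …, vₖ distinct.

IsCycle : ∀ {n} → Graph n → Fin n → List (Fin n) → Set
IsCycle G v vs =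
  2 ≤ length vs × Unique (v ∷ vs) × Linked (Adj G) (v ∷ (vs ∷ʳ v))

Acyclic : ∀ {n} → Graph n → Set
Acyclic G = ∀ v vs → ¬ IsCycle G v vs

IsTree : ∀ {n} → Graph n → Set
IsTree G = Connected G × Acyclic G

-- A spanning subgraph of G is a graph on the same vertex set Fin n.

IsSpanningTree : ∀ {n} → Graph n → Graph n → Set
IsSpanningTree T G = (Adj T ⇒ Adj G) × IsTree T

module _ {n : ℕ} (G : Graph n) where

  Dominating : Subset n → Set
  Dominating D = ∀ v → v ∈ D ⊎ ∃ λ u → u ∈ D × Adj G u v

  PerfectMatching : Subset n → Subset n → Set
  PerfectMatching D D′ =
    Σ (∃ (_∈ D) ⤖ ∃ (_∈ D′)) λ f →
      ∀ x → Adj G (proj₁ x) (proj₁ (Bijection.to f x))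

  IsSwapSet : Subset n → Set
  IsSwapSet D = Dominating D × ∃ λ D′ →
    Dominating D′ × Empty (D ∩ D′) × ∣ D ∣ ≡ ∣ D′ ∣ × PerfectMatching D D′

  -- ℕ ⁺ is ℕ with a top element ⊤⁺, which plays the role of ∞.

  IsSwapNumber : ℕ ⁺ → Set
  IsSwapNumber [ k ] = (∃ λ D → IsSwapSet D × ∣ D ∣ ≡ k)
                     × (∀ D → IsSwapSet D → k ≤ ∣ D ∣)
  IsSwapNumber ⊤⁺    = ∀ D → ¬ IsSwapSet D

private
  anyVec? : ∀ {n k} {P : Pred (Vec (Fin n) k) 0ℓ} → Decidable₁ P → Dec (∃ P)
  anyVec? {k = zero}  P? = map′ ([] ,_) (λ where ([] , p) → p) (P? [])
  anyVec? {k = suc _} P? =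
    map′ (λ where (x , xs , p) → x ∷ xs , p)
         (λ where (x ∷ xs , p) → x , xs , p)
         (any? λ x → anyVec? λ xs → P? (x ∷ xs))

  ∈-≡ : ∀ {n} {D : Subset n} {x y : ∃ (_∈ D)} → proj₁ x ≡ proj₁ y → x ≡ y
  ∈-≡ {x = x , p} {y = .x , q} refl = cong (x ,_) ([]=-irrelevant p q)

module _ {n : ℕ} (G : Graph n) where

  dominating? : Decidable₁ (Dominating G)
  dominating? D = all? λ v → v ∈? D ⊎-dec any? λ u → u ∈? D ×-dec Adj? G u v

  private
    module _ (D D′ : Subset n) where

      -- xs encodes a matching whose value at x ∈ D is lookup xs x; the
      -- entries of xs outside D are ignored.

      Matches : Vec (Fin n) n → Set
      Matches xs =
          (∀ x → x ∈ D → lookup xs x ∈ D′ × Adj G x (lookup xs x))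
        × (∀ x → x ∈ D → ∀ y → y ∈ D → lookup xs x ≡ lookup xs y → x ≡ y)
        × (∀ z → z ∈ D′ → ∃ λ x → x ∈ D × lookup xs x ≡ z)

      matches? : Decidable₁ Matches
      matches? xs =
              all? (λ x → x ∈? D →-dec
                (lookup xs x ∈? D′ ×-dec Adj? G x (lookup xs x)))
        ×-dec all? (λ x → x ∈? D →-dec all? λ y → y ∈? D →-dec
                (lookup xs x ≟ lookup xs y →-dec x ≟ y))
        ×-dec all? (λ z → z ∈? D′ →-dec any? λ x →
                x ∈? D ×-dec lookup xs x ≟ z)

      fromMatches : ∃ Matches → PerfectMatching G D D′
      fromMatches (xs , adj , inj , surj) =
        mk⤖ {to = λ (x , p) → lookup xs x , proj₁ (adj x p)}
          ( (λ {x} {y} e →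
               ∈-≡ (inj (proj₁ x) (proj₂ x) (proj₁ y) (proj₂ y) (cong proj₁ e)))
          , λ (z , q) → let x , p , e = surj z q in
              (x , p) , λ where refl → ∈-≡ e)
        , λ (x , p) → proj₂ (adj x p)

      toMatches : PerfectMatching G D D′ → ∃ Matches
      toMatches (f , adj) = xs , adj′ , inj′ , surj′
        where
        open Bijection f using (to; injective; surjective)

        val : ∀ x → Dec (x ∈ D) → Fin n
        val x (yes p) = proj₁ (to (x , p))
        val x (no _)  = x

        xs : Vec (Fin n) n
        xs = tabulate λ x → val x (x ∈? D)

        val≡ : ∀ x (p : x ∈ D) (d : Dec (x ∈ D)) → val x d ≡ proj₁ (to (x , p))
        val≡ x p (yes q) = cong (λ r → proj₁ (to (x , r))) ([]=-irrelevant q p)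
        val≡ x p (no ¬p) = contradiction p ¬p

        xs≡ : ∀ x (p : x ∈ D) → lookup xs x ≡ proj₁ (to (x , p))
        xs≡ x p = trans (lookup∘tabulate _ x) (val≡ x p (x ∈? D))

        adj′ : ∀ x → x ∈ D → lookup xs x ∈ D′ × Adj G x (lookup xs x)
        adj′ x p = subst (λ y → y ∈ D′ × Adj G x y) (sym (xs≡ x p))
          (proj₂ (to (x , p)) , adj (x , p))

        inj′ : ∀ x → x ∈ D → ∀ y → y ∈ D → lookup xs x ≡ lookup xs y → x ≡ y
        inj′ x p y q e = cong proj₁
          (injective (∈-≡ (trans (sym (xs≡ x p)) (trans e (xs≡ y q)))))

        surj′ : ∀ z → z ∈ D′ → ∃ λ x → x ∈ D × lookup xs x ≡ z
        surj′ z q = let (x , p) , e = surjective (z , q) in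
          x , p , trans (xs≡ x p) (cong proj₁ (e refl))

  perfectMatching? : Decidable (PerfectMatching G)
  perfectMatching? D D′ =
    map′ (fromMatches D D′) (toMatches D D′) (anyVec? (matches? D D′))

  isSwapSet? : Decidable₁ (IsSwapSet G)
  isSwapSet? D = dominating? D ×-dec anySubset? λ D′ →
          dominating? D′
    ×-dec ¬? (nonempty? (D ∩ D′))
    ×-dec (∣ D ∣ ≟ℕ ∣ D′ ∣)
    ×-dec perfectMatching? D D′

  private
    minimise : ∀ k → (∃ λ D → IsSwapSet G D × ∣ D ∣ ≡ k) →
               ∃ λ l → IsSwapNumber G [ l ]
    minimise = <-rec _ step
      where
      step : ∀ k →
             (∀ {l} → l < k → (∃ λ D → IsSwapSet G D × ∣ D ∣ ≡ l) →
              ∃ λ j → IsSwapNumber G [ j ]) →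
             (∃ λ D → IsSwapSet G D × ∣ D ∣ ≡ k) →
             ∃ λ j → IsSwapNumber G [ j ]
      step k rec w with anySubset? (λ D → isSwapSet? D ×-dec ∣ D ∣ <? k)
      ... | yes (D , s , lt) = rec lt (D , s , refl)
      ... | no ∄ = k , w , λ D s → ≮⇒≥ λ lt → ∄ (D , s , lt)

  swapNumber : ∃ (IsSwapNumber G)
  swapNumber with anySubset? isSwapSet?
  ... | yes (D , s) = let k , p = minimise ∣ D ∣ (D , s , refl) in [ k ] , p
  ... | no ∄        = ⊤⁺ , λ D s → ∄ (D , s)

  DDₘ : ℕ ⁺
  DDₘ = proj₁ swapNumber

  DDₘ-isSwapNumber : IsSwapNumber G DDₘ
  DDₘ-isSwapNumber = proj₂ swapNumber

{-# OPTIONS --safe #-}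
module Submission where

open import Defs
open import Data.Nat.Base using (ℕ; _≤_)
open import Data.Product.Base using (_,_)
import Data.Product.Base as Product
import Data.Sum.Base as Sum
open import Function.Base using (id; _∘_)
open import Relation.Binary.Construct.Add.Supremum.NonStrict _≤_ using ([_]; _≤⊤⁺)
open import Relation.Binary.Core using (_⇒_)
open import Relation.Binary.PropositionalEquality using (refl)
open import Relation.Nullary using (contradiction)
open import Relation.Nullary.Construct.Add.Supremum using ([_]; ⊤⁺)

-- Adding edges on a fixed vertex set keeps every swap set a swap set, so it can only lower `DDₘ`,
-- even when `DDₘ` is infinite. The product is monotone in both factors, so `T □ T′` is a spanning
-- subgraph of `G □ H`.

module _ {n : ℕ} (K L : Graph n) (K⊆L : Adj K ⇒ Adj L) where

  dominating-mono : ∀ {D} → Dominating K D → Dominating L D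
  dominating-mono dom v =
    Sum.map id (Product.map id (Product.map id K⊆L)) (dom v)

  -- Domination and matching only ask that certain edges exist; disjointness and size mention no
  -- edges. So the same `D′` and bijection `f` serve in `L`.
  isSwapSet-mono : ∀ {D} → IsSwapSet K D → IsSwapSet L D
  isSwapSet-mono (dom , D′ , dom′ , disjoint , size , f , adj) =
    dominating-mono dom , D′ , dominating-mono dom′ , disjoint , size ,
    f , K⊆L ∘ adj

  isSwapNumber-anti : ∀ {k l} → IsSwapNumber L l → IsSwapNumber K k → l ≤∞ k
  isSwapNumber-anti {⊤⁺}            _         _                    = _ ≤⊤⁺
  -- A finite value for `K` rules out an infinite one for `L`: the minimiser of `K` is a swap set of
  -- `L`.
  isSwapNumber-anti {[ _ ]} {⊤⁺}    none      ((D , s , _) , _)    =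
    contradiction (isSwapSet-mono s) (none D)
  -- The minimiser of `K` competes in the minimum for `L`.
  isSwapNumber-anti {[ _ ]} {[ _ ]} (_ , min) ((D , s , refl) , _) =
    [ min D (isSwapSet-mono s) ]

  DDₘ-anti : DDₘ L ≤∞ DDₘ K
  DDₘ-anti = isSwapNumber-anti (DDₘ-isSwapNumber L) (DDₘ-isSwapNumber K)

-- A product edge fixes one coordinate and follows a factor edge in the other, so each kind of edge
-- maps to its own kind.
□-mono : ∀ {m n} (K L : Graph m) (K′ L′ : Graph n) →
  Adj K ⇒ Adj L → Adj K′ ⇒ Adj L′ → Adj (K □ K′) ⇒ Adj (L □ L′)
□-mono _ _ _ _ K⊆L K′⊆L′ =
  Sum.map (Product.map id K′⊆L′) (Product.map K⊆L id)

corollary27 : (m n : ℕ) (G : Graph m) (H : Graph n) →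
    NonTrivial G → NonTrivial H →
    (T : Graph m) (T′ : Graph n) →
    IsSpanningTree T G → IsSpanningTree T′ H →
    DDₘ (G □ H) ≤∞ DDₘ (T □ T′)
corollary27 m n G H _ _ T T′ (T⊆G , _) (T′⊆H , _) =
  -- Product adjacency sees `u` and `v` only through `remQuot`, so they are passed explicitly.
  DDₘ-anti (T □ T′) (G □ H) λ {u} {v} →
    □-mono T G T′ H T⊆G T′⊆H {u} {v}
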